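{- In $NOM$, for every finite sequence $\Gamma$ of formulas and all formulas $\phi,\psi$, the following rule is derivable: from $\Gamma\vdash\psi$ and $\Gamma,\phi\vdash\psi$ infer $\Gamma,\neg\phi\vdash\psi$.
   Context: The propositional deductive system $NOM$: formulas are built from propositional letters using $\wedge$, $\rightarrow$, $\neg$. Sequents are $\phi_1,\ldots,\phi_n\vdash\psi$ ($n\ge0$) with antecedent a finite ordered sequence. With $\Gamma$ a finite possibly empty sequence of formulas and $\phi,\psi,\chi$ formulas, the rules of $NOM$ are: (assumption) $\Gamma,\phi\vdash\phi$; (cut) $\Gamma\vdash\phi$, $\Gamma,\phi\vdash\psi$ $\Rightarrow$ $\Gamma\vdash\psi$; (paste) $\Gamma\vdash\phi$, $\Gamma\vdash\psi$ $\Rightarrow$ $\Gamma,\phi\vdash\psi$; (compatible exchange) $\Gamma,\phi,\psi\vdash\phi$, $\Gamma,\phi,\psi\vdash\chi$, $\Gamma,\psi,\phi\vdash\psi$ $\Rightarrow$ $\Gamma,\psi,\phi\vdash\chi$; ($\wedge$-intro) $\Gamma\vdash\phi$, $\Gamma\vdash\psi$ $\Rightarrow$ $\Gamma\vdash\phi\wedge\psi$; ($\wedge$-elim) $\Gamma\vdash\phi\wedge\psi$ $\Rightarrow$ $\Gamma\vdash\phi$ and $\Rightarrow$ $\Gamma\vdash\psi$; ($\rightarrow$-intro) $\Gamma,\phi\vdash\psi$ $\Rightarrow$ $\Gamma\vdash\phi\rightarrow\psi$; ($\rightarrow$-elim) $\Gamma\vdash\phi\rightarrow\psi$ $\Rightarrow$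 $\Gamma,\phi\vdash\psi$; (excluded middle) $\Gamma,\phi\vdash\psi$, $\Gamma,\neg\phi\vdash\psi$ $\Rightarrow$ $\Gamma\vdash\psi$; (explosion) $\Gamma\vdash\neg\phi$ $\Rightarrow$ $\Gamma,\phi\vdash\psi$. A rule schema is derivable if in every instance its conclusion can be derived from its premises using these rules. -}

module Defs where

open import Data.List using (List; []; _∷_)
open import Data.List.Membership.Propositional using (_∈_)

infix  9 ¬_
infixr 8 _∧_
infixr 7 _⇒_
infixl 6 _▸_
infix  5 _⊢_
infix  4 _⟹_

data Formula (Letter : Set) : Set where
  letter : Letter → Formula Letter
  _∧_    : Formula Letter → Formula Letter → Formula Letter
  _⇒_    : Formula Letter → Formula Letter → Formula Letter
  ¬_     : Formula Letter → Formula Letter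

-- Antecedents φ₁,…,φₙ are stored last formula first, so that "Γ,φ" is a
-- constructor form: [] ▸ φ₁ ▸ … ▸ φₙ.
Antecedent : Set → Set
Antecedent Letter = List (Formula Letter)

pattern _▸_ Γ φ = φ ∷ Γ

record Sequent (Letter : Set) : Set where
  constructor _⊢_
  field
    antecedent : Antecedent Letter
    succedent  : Formula Letter

-- Ps ⟹ s is the type of NOM-derivations of s whose leaves may also be
-- sequents of Ps.  A rule with premises Ps and conclusion s is derivable when
-- Ps ⟹ s holds for each of its instances; this is in general stronger than
-- admissibility, ([] ⟹ every premise) → ([] ⟹ s).
data _⟹_ {Letter : Set} (Ps : List (Sequent Letter)) : Sequent Letter → Set where
  premise             : ∀ {s} → s ∈ Ps → Ps ⟹ s
  assumption          : ∀ {Γ φ} → Ps ⟹ Γ ▸ φ ⊢ φ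
  cut                 : ∀ {Γ φ ψ} → Ps ⟹ Γ ⊢ φ → Ps ⟹ Γ ▸ φ ⊢ ψ → Ps ⟹ Γ ⊢ ψ
  paste               : ∀ {Γ φ ψ} → Ps ⟹ Γ ⊢ φ → Ps ⟹ Γ ⊢ ψ → Ps ⟹ Γ ▸ φ ⊢ ψ
  compatible-exchange : ∀ {Γ φ ψ χ} → Ps ⟹ Γ ▸ φ ▸ ψ ⊢ φ → Ps ⟹ Γ ▸ φ ▸ ψ ⊢ χ →
                        Ps ⟹ Γ ▸ ψ ▸ φ ⊢ ψ → Ps ⟹ Γ ▸ ψ ▸ φ ⊢ χ
  ∧-intro             : ∀ {Γ φ ψ} → Ps ⟹ Γ ⊢ φ → Ps ⟹ Γ ⊢ ψ → Ps ⟹ Γ ⊢ φ ∧ ψ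
  ∧-elimˡ             : ∀ {Γ φ ψ} → Ps ⟹ Γ ⊢ φ ∧ ψ → Ps ⟹ Γ ⊢ φ
  ∧-elimʳ             : ∀ {Γ φ ψ} → Ps ⟹ Γ ⊢ φ ∧ ψ → Ps ⟹ Γ ⊢ ψ
  ⇒-intro             : ∀ {Γ φ ψ} → Ps ⟹ Γ ▸ φ ⊢ ψ → Ps ⟹ Γ ⊢ φ ⇒ ψ
  ⇒-elim              : ∀ {Γ φ ψ} → Ps ⟹ Γ ⊢ φ ⇒ ψ → Ps ⟹ Γ ▸ φ ⊢ ψ
  excluded-middle     : ∀ {Γ φ ψ} → Ps ⟹ Γ ▸ φ ⊢ ψ → Ps ⟹ Γ ▸ ¬ φ ⊢ ψ → Ps ⟹ Γ ⊢ ψ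
  explosion           : ∀ {Γ φ ψ} → Ps ⟹ Γ ⊢ ¬ φ → Ps ⟹ Γ ▸ φ ⊢ ψ

{-# OPTIONS --safe #-}
-- Put ε = φ ∧ ψ and δ = ψ ∧ (φ ⇒ ψ), so that the premises give Γ ⊢ δ.  Since ε
-- entails δ and φ, it is compatible with both, and hence so is ¬ ε.  Under ε, the
-- formula φ contradicts ¬ φ; under ¬ ε, δ the formula φ is refuted, because it
-- would yield ε, so ¬ φ can be pasted onto ψ.  As Γ itself need not be compatible
-- with ε, the case distinction is made on the goal Γ ⊢ δ ⇒ ¬ φ ⇒ ψ.
module Submission where

open import Data.List using (List; []; _∷_)
open import Data.List.Relation.Unary.Any using (here; there)
open import Data.Product using (_×_; _,_; proj₁; proj₂)
open import Relation.Binary.PropositionalEquality using (refl)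
open import Defs

module _ {Letter : Set} {Ps : List (Sequent Letter)} where

  modus-ponens : ∀ {Γ φ ψ} → Ps ⟹ Γ ⊢ φ ⇒ ψ → Ps ⟹ Γ ⊢ φ → Ps ⟹ Γ ⊢ ψ
  modus-ponens f p = cut p (⇒-elim f)

  contradiction : ∀ {Γ φ χ} → Ps ⟹ Γ ⊢ φ → Ps ⟹ Γ ⊢ ¬ φ → Ps ⟹ Γ ⊢ χ
  contradiction p ¬p = cut p (explosion ¬p)

  ¬-intro : ∀ {Γ φ} → Ps ⟹ Γ ▸ φ ⊢ ¬ φ → Ps ⟹ Γ ⊢ ¬ φ
  ¬-intro p = excluded-middle p assumption

  ¬¬-elim : ∀ {Γ φ} → Ps ⟹ Γ ⊢ ¬ ¬ φ → Ps ⟹ Γ ⊢ φ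
  ¬¬-elim p = excluded-middle assumption (explosion p)

  -- Exchange is not available for φ, ¬ φ at this point; splitting on ¬ φ before
  -- φ is introduced avoids it.
  ⇒¬¬ : ∀ {Γ φ} → Ps ⟹ Γ ⊢ φ ⇒ ¬ ¬ φ
  ⇒¬¬ = excluded-middle
    (⇒-intro (explosion assumption))
    (⇒-intro (paste (¬¬-elim assumption) assumption))

  explosion-¬ : ∀ {Γ φ χ} → Ps ⟹ Γ ⊢ φ → Ps ⟹ Γ ▸ ¬ φ ⊢ χ
  explosion-¬ p = explosion (modus-ponens ⇒¬¬ p)

  -- Asked of every `Γ`, so that it can be used after further hypotheses.
  Compatible : Formula Letter → Formula Letter → Set
  Compatible φ ψ = ∀ {Γ} → (Ps ⟹ Γ ▸ φ ▸ ψ ⊢ φ) × (Ps ⟹ Γ ▸ ψ ▸ φ ⊢ ψ)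

  exchange : ∀ {Γ φ ψ χ} → Compatible φ ψ →
    Ps ⟹ Γ ▸ φ ▸ ψ ⊢ χ → Ps ⟹ Γ ▸ ψ ▸ φ ⊢ χ
  exchange c p = compatible-exchange (proj₁ c) p (proj₂ c)

  entails⇒compatible : ∀ {φ ψ} → (∀ {Γ} → Ps ⟹ Γ ▸ φ ⊢ ψ) → Compatible φ ψ
  entails⇒compatible φ⊢ψ = paste φ⊢ψ assumption , φ⊢ψ

  compatible-¬ : ∀ {φ ψ} → Compatible φ ψ → Compatible (¬ φ) ψ
  compatible-¬ {φ} {ψ} c = keeps-¬φ , ⇒-elim (⇒-elim ψ⇒¬φ⇒ψ)
    where
    keeps-¬φ : ∀ {Γ} → Ps ⟹ Γ ▸ ¬ φ ▸ ψ ⊢ ¬ φ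
    -- The exchange moves `φ` next to `¬ φ`, where explosion applies.
    keeps-¬φ = ¬-intro (exchange c (⇒-elim (explosion assumption)))

    ψ⇒¬φ⇒ψ : ∀ {Γ} → Ps ⟹ Γ ⊢ ψ ⇒ ¬ φ ⇒ ψ
    -- Split before `ψ` enters: `φ` survives `ψ` and contradicts `¬ φ`; `¬ φ` survives `ψ` and can
    -- be pasted.
    ψ⇒¬φ⇒ψ = excluded-middle
      (⇒-intro (⇒-intro (explosion-¬ (proj₁ c))))
      (⇒-intro (⇒-intro (paste keeps-¬φ assumption)))

  ∧⇒-entails-¬⇒ : ∀ {Γ} φ ψ → Ps ⟹ Γ ⊢ ψ ∧ (φ ⇒ ψ) ⇒ ¬ φ ⇒ ψ
  ∧⇒-entails-¬⇒ φ ψ = excluded-middle {φ = ε}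
    (⇒-intro (⇒-intro (explosion-¬ (∧-elimˡ (proj₁ ε~δ)))))
    (⇒-intro (⇒-intro (paste ¬φ (∧-elimˡ assumption))))
    where
    ε δ : Formula Letter
    ε = φ ∧ ψ
    δ = ψ ∧ (φ ⇒ ψ)

    ε~φ : Compatible ε φ
    ε~φ = entails⇒compatible (∧-elimˡ assumption)

    ε~δ : Compatible ε δ
    ε~δ = entails⇒compatible
      (∧-intro (∧-elimʳ assumption)
               (⇒-intro (paste (∧-elimˡ assumption) (∧-elimʳ assumption))))

    ¬φ : ∀ {Γ} → Ps ⟹ Γ ▸ ¬ ε ▸ δ ⊢ ¬ φ
    ¬φ = ¬-intro (contradiction
      (∧-intro assumption (⇒-elim (∧-elimʳ assumption)))
      -- The cut restates `¬ ε` after `δ`, adjacent to `φ` as `compatible-¬ ε~φ` requires.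
      (⇒-elim (cut (proj₁ (compatible-¬ ε~δ))
                   (⇒-intro (proj₁ (compatible-¬ ε~φ))))))

theorem4p4 : (Letter : Set) (Γ : Antecedent Letter) (φ ψ : Formula Letter) →
    (Γ ⊢ ψ) ∷ (Γ ▸ φ ⊢ ψ) ∷ [] ⟹ (Γ ▸ ¬ φ ⊢ ψ)
theorem4p4 Letter Γ φ ψ = ⇒-elim (modus-ponens (∧⇒-entails-¬⇒ φ ψ)
  (∧-intro (premise (here refl)) (⇒-intro (premise (there (here refl))))))
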